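{- Let $n\ge3$ and $B_n=\langle a,b\mid ba=b^n\rangle$. 1. $\mathcal L(B_n)$ is closed under set addition, i.e. $L_1+L_2\in\mathcal L(B_n)$ for all $L_1,L_2\in\mathcal L(B_n)$; hence $\mathcal L(B_n)$ is a monoid under set addition with identity $\{0\}$. 2. The map $\Phi:\mathcal L(B_n)\to H$, $x+(n-2)\cdot[0,q]\mapsto(x,q)$, is a monoid isomorphism onto $H=\{(k,i)\mid k,i\in\mathbb N_0,\ k=i=0\text{ or }k>i\}\subset(\mathbb N_0^2,+)$. Moreover, $H$ is a reduced atomic commutative cancellative half-factorial monoid with $\mathcal A(H)=\{(k,k-1)\mid k\in\mathbb N\}$.
   Context: $B_n$ is the monoid with generators $a,b$ and single relation $ba=b^n$; its atoms are $a,b$. $\mathsf L(y)$ is the set of $k$ such that $y$ is a product of $k$ atoms ($\mathsf L(1)=\{0\}$), $\mathcal L(B_n)=\{\mathsf L(y)\mid y\in B_n\}$; every element of $\mathcal L(B_n)$ has the form $x+(n-2)\cdot[0,q]=\{x,x+(n-2),\dots,x+q(n-2)\}$ with $x,q\in\mathbb N_0$ and ($x=q=0$ or $x>q$), uniquely determined by $(x,q)$. For sets $L_1,L_2\subset\mathbb Z$, $L_1+L_2=\{l_1+l_2\mid l_i\in L_i\}$. A monoid is half-factorial if every non-unit's factorizations into atoms all have the same length; $\mathcal A(H)$ denotes the set of atoms. -}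

module Defs where

open import Level using (Level; _⊔_; 0ℓ) renaming (suc to lsuc)
open import Algebra.Bundles using (Monoid)
open import Algebra.Bundles.Raw using (RawMonoid)
import Algebra.Definitions as AlgDefs
open import Data.List.Base using (List; []; _∷_; _++_; foldr; length; replicate)
open import Data.List.Properties using (++-assoc; ++-identityʳ)
open import Data.List.Relation.Unary.All using (All)
open import Data.Nat.Base using (ℕ; _+_; _*_; _<_; _≤_)
open import Data.Nat.Properties using (+-identityʳ; +-mono-<)
open import Data.Product.Base using (Σ; ∃; ∃-syntax; _×_; _,_; proj₁; proj₂)
open import Data.Sum.Base using (_⊎_; inj₁; inj₂)
open import Relation.Binary.Core using (Rel)
open import Relation.Binary.PropositionalEquality using (_≡_; refl; sym; subst₂)
open import Relation.Nullary.Negation.Core using (¬_)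
open import Relation.Unary using (Pred; _∈_; _≐_; ｛_｝)

module Factorization {c ℓ : Level} (M : RawMonoid c ℓ) where
  open RawMonoid M
  open AlgDefs _≈_ using (Invertible)

  IsUnit : Pred Carrier (c ⊔ ℓ)
  IsUnit u = Invertible ε _∙_ u

  IsAtom : Pred Carrier (c ⊔ ℓ)
  IsAtom u = ¬ IsUnit u × (∀ x y → u ≈ x ∙ y → IsUnit x ⊎ IsUnit y)

  prod : List Carrier → Carrier
  prod = foldr _∙_ ε

  -- The empty product gives 0 ∈ 𝖫 ε; in a reduced monoid 𝖫 ε is exactly ｛ 0 ｝.
  𝖫 : Carrier → Pred ℕ (c ⊔ ℓ)
  𝖫 y k = ∃[ us ] (length us ≡ k × All IsAtom us × prod us ≈ y)

  𝓛 : Pred (Pred ℕ (c ⊔ ℓ)) (c ⊔ ℓ)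
  𝓛 L = ∃[ y ] (L ≐ 𝖫 y)

  Reduced : Set (c ⊔ ℓ)
  Reduced = ∀ u → IsUnit u → u ≈ ε

  Atomic : Set (c ⊔ ℓ)
  Atomic = ∀ x → ¬ IsUnit x → ∃[ us ] (All IsAtom us × prod us ≈ x)

  HalfFactorial : Set (c ⊔ ℓ)
  HalfFactorial = ∀ x → ¬ IsUnit x → ∀ k l → k ∈ 𝖫 x → l ∈ 𝖫 x → k ≡ l

open Factorization public

module Presentation {X : Set} (R : Rel (List X) 0ℓ) where

  infix 4 _∼_

  -- The monoid congruence on words generated by R.
  data _∼_ : Rel (List X) 0ℓ where
    relation : ∀ {u v} → R u v → u ∼ v
    ∼-refl   : ∀ {u} → u ∼ u
    ∼-sym    : ∀ {u v} → u ∼ v → v ∼ u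
    ∼-trans  : ∀ {u v w} → u ∼ v → v ∼ w → u ∼ w
    ∼-cong   : ∀ {u u′ v v′} → u ∼ u′ → v ∼ v′ → u ++ v ∼ u′ ++ v′

  ≡⇒∼ : ∀ {u v} → u ≡ v → u ∼ v
  ≡⇒∼ refl = ∼-refl

  monoid : Monoid 0ℓ 0ℓ
  monoid = record
    { Carrier  = List X
    ; _≈_      = _∼_
    ; _∙_      = _++_
    ; ε        = []
    ; isMonoid = record
      { isSemigroup = record
        { isMagma = record
          { isEquivalence = record { refl = ∼-refl ; sym = ∼-sym ; trans = ∼-trans }
          ; ∙-cong        = ∼-cong
          }
        ; assoc = λ u v w → ≡⇒∼ (++-assoc u v w)
        }
      ; identity = (λ _ → ∼-refl) , (λ u → ≡⇒∼ (++-identityʳ u))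
      }
    }

data Gen : Set where
  a b : Gen

data BRel (n : ℕ) : Rel (List Gen) 0ℓ where
  ba≈bⁿ : BRel n (b ∷ a ∷ []) (replicate n b)

B : ℕ → RawMonoid 0ℓ 0ℓ
B n = Monoid.rawMonoid (Presentation.monoid (BRel n))

infixl 6 _⊕_

_⊕_ : Pred ℕ 0ℓ → Pred ℕ 0ℓ → Pred ℕ 0ℓ
(L₁ ⊕ L₂) m = ∃[ l₁ ] ∃[ l₂ ] (l₁ ∈ L₁ × l₂ ∈ L₂ × m ≡ l₁ + l₂)

ClosedUnder⊕ : Pred (Pred ℕ 0ℓ) 0ℓ → Set₁
ClosedUnder⊕ 𝓕 = ∀ L₁ L₂ → L₁ ∈ 𝓕 → L₂ ∈ 𝓕 → L₁ ⊕ L₂ ∈ 𝓕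

-- A family of subsets of ℕ under set addition, with extensional equality of sets.
sumsetRawMonoid : (𝓕 : Pred (Pred ℕ 0ℓ) 0ℓ) → ClosedUnder⊕ 𝓕 → ｛ 0 ｝ ∈ 𝓕 → RawMonoid (lsuc 0ℓ) 0ℓ
sumsetRawMonoid 𝓕 closed 0∈𝓕 = record
  { Carrier = Σ (Pred ℕ 0ℓ) 𝓕
  ; _≈_     = λ L₁ L₂ → proj₁ L₁ ≐ proj₁ L₂
  ; _∙_     = λ L₁ L₂ → proj₁ L₁ ⊕ proj₁ L₂ , closed (proj₁ L₁) (proj₁ L₂) (proj₂ L₁) (proj₂ L₂)
  ; ε       = ｛ 0 ｝ , 0∈𝓕
  }

infix 7 _+_·[0,_]

_+_·[0,_] : ℕ → ℕ → ℕ → Pred ℕ 0ℓ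
(x + d ·[0, q ]) m = ∃[ j ] (j ≤ q × m ≡ x + d * j)

InH : Pred (ℕ × ℕ) 0ℓ
InH (k , i) = (k ≡ 0 × i ≡ 0) ⊎ i < k

InH-+ : ∀ {k i k′ i′} → InH (k , i) → InH (k′ , i′) → InH (k + k′ , i + i′)
InH-+ (inj₁ (refl , refl)) q = q
InH-+ (inj₂ p) (inj₁ (refl , refl)) = inj₂ (subst₂ _<_ (sym (+-identityʳ _)) (sym (+-identityʳ _)) p)
InH-+ (inj₂ p) (inj₂ q) = inj₂ (+-mono-< p q)

-- Equality in H is equality of the underlying pairs.
H : RawMonoid 0ℓ 0ℓ
H = record
  { Carrier = Σ (ℕ × ℕ) InH
  ; _≈_     = λ g h → proj₁ g ≡ proj₁ h
  ; _∙_     = λ { ((k , i) , p) ((k′ , i′) , q) → (k + k′ , i + i′) , InH-+ p q }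
  ; ε       = (0 , 0) , inj₁ (refl , refl)
  }

{-# OPTIONS --safe #-}
module Submission where

-- Prepending letters to normal forms aⁱbʲ by b·aⁱbʲ = b^(1+(n-1)i+j) defines an action of B_n on ℕ²,
-- so distinct normal forms are distinct elements. The length of a word with normal form aⁱbʲ
-- is then i + j − (n−2)t, where t is the number of letters a to the right of some b, and t ranges
-- over 0 ≤ t ≤ (j−1)/(n−1). Hence sets of lengths are the progressions x + (n−2)·[0,q] with (x,q) ∈ H,
-- and these add componentwise. In H, the function (k , i) ↦ k − i is additive, positive off zero,
-- and equal to 1 exactly at the atoms.

open import Defs
open import Level using (0ℓ)
open import Algebra.Bundles.Raw using (RawMonoid)
open import Algebra.Definitions using (Cancellative)
open import Algebra.Structures using (IsMonoid; IsCommutativeMonoid)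
open import Algebra.Morphism.Structures using (IsMonoidIsomorphism)
open import Data.List.Base using (List; []; _∷_; _++_; foldr; length; map; replicate)
open import Data.List.Properties using (foldr-++; length-++; length-map; length-replicate)
open import Data.List.Relation.Unary.All using (All; []; _∷_)
open import Data.List.Relation.Unary.All.Properties using (replicate⁺)
open import Data.Nat.Base using (ℕ; zero; suc; pred; _+_; _*_; _∸_; _⊓_; _≤_; NonZero; z≤n; s≤s)
open import Data.Nat.DivMod using (_/_; _%_; m≡m%n+[m/n]*n; m*n/n≡m; m*n%n≡0; /-monoˡ-≤)
open import Data.Nat.Properties
open import Data.Nat.Tactic.RingSolver using (solve-∀)
open import Data.Product.Base using (Σ; Σ-syntax; ∃-syntax; _×_; _,_; proj₁; proj₂)
open import Data.Sum.Base using (_⊎_; inj₁; inj₂)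
open import Function.Base using (_∘_; id)
open import Function.Bundles using (_⇔_; mk⇔)
open import Relation.Binary.PropositionalEquality using (_≡_; refl; sym; trans; cong; cong₂; subst; module ≡-Reasoning)
open import Relation.Nullary.Negation.Core using (¬_; contradiction)
open import Relation.Unary using (Pred; _∈_; _≐_; ｛_｝)

private
  module ℋ = RawMonoid H

-- Sumsets of subsets of ℕ.

≐-refl : {P : Pred ℕ 0ℓ} → P ≐ P
≐-refl = id , id

≐-sym : {P Q : Pred ℕ 0ℓ} → P ≐ Q → Q ≐ P
≐-sym (f , g) = g , f

≐-trans : {P Q R : Pred ℕ 0ℓ} → P ≐ Q → Q ≐ R → P ≐ R
≐-trans (f , g) (f′ , g′) = f′ ∘ f , g ∘ g′

⊕-cong : {P P′ Q Q′ : Pred ℕ 0ℓ} → P ≐ P′ → Q ≐ Q′ → P ⊕ Q ≐ P′ ⊕ Q′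
⊕-cong (f , f⁻) (g , g⁻) =
  (λ (k , l , k∈P , l∈Q , eq) → k , l , f k∈P , g l∈Q , eq) ,
  (λ (k , l , k∈P , l∈Q , eq) → k , l , f⁻ k∈P , g⁻ l∈Q , eq)

⊕-assoc : (P Q R : Pred ℕ 0ℓ) → (P ⊕ Q) ⊕ R ≐ P ⊕ (Q ⊕ R)
⊕-assoc P Q R =
  (λ { (_ , m , (k , l , k∈P , l∈Q , refl) , m∈R , refl) →
       k , l + m , k∈P , (l , m , l∈Q , m∈R , refl) , +-assoc k l m }) ,
  (λ { (k , _ , k∈P , (l , m , l∈Q , m∈R , refl) , refl) →
       k + l , m , (k , l , k∈P , l∈Q , refl) , m∈R , sym (+-assoc k l m) })

⊕-identityˡ : (P : Pred ℕ 0ℓ) → ｛ 0 ｝ ⊕ P ≐ P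
⊕-identityˡ P =
  (λ { (_ , _ , refl , l∈P , refl) → l∈P }) ,
  (λ {l} l∈P → 0 , l , refl , l∈P , refl)

⊕-identityʳ : (P : Pred ℕ 0ℓ) → P ⊕ ｛ 0 ｝ ≐ P
⊕-identityʳ P =
  (λ { (k , _ , k∈P , refl , refl) → subst P (sym (+-identityʳ k)) k∈P }) ,
  (λ {k} k∈P → k , 0 , k∈P , refl , sym (+-identityʳ k))

sumset-isMonoid : (𝓕 : Pred (Pred ℕ 0ℓ) 0ℓ) (closed : ClosedUnder⊕ 𝓕) (0∈𝓕 : ｛ 0 ｝ ∈ 𝓕) →
  let open RawMonoid (sumsetRawMonoid 𝓕 closed 0∈𝓕) in IsMonoid _≈_ _∙_ ε
sumset-isMonoid 𝓕 closed 0∈𝓕 = record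
  { isSemigroup = record
    { isMagma = record
      { isEquivalence = record { refl = ≐-refl ; sym = ≐-sym ; trans = ≐-trans }
      ; ∙-cong        = ⊕-cong
      }
    ; assoc = λ P Q R → ⊕-assoc (proj₁ P) (proj₁ Q) (proj₁ R)
    }
  ; identity = (λ P → ⊕-identityˡ (proj₁ P)) , (λ P → ⊕-identityʳ (proj₁ P))
  }

-- Arithmetic progressions under set addition.

｛0｝≐progression : ∀ d → ｛ 0 ｝ ≐ (0 + d ·[0, 0 ])
｛0｝≐progression d =
  (λ { refl → 0 , z≤n , sym (*-zeroʳ d) }) ,
  (λ { (_ , z≤n , refl) → sym (*-zeroʳ d) })

progression-⊕ : ∀ d x q x′ q′ →
  (x + d ·[0, q ]) ⊕ (x′ + d ·[0, q′ ]) ≐ ((x + x′) + d ·[0, q + q′ ])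
progression-⊕ d x q x′ q′ =
  (λ { (_ , _ , (j , j≤q , refl) , (j′ , j′≤q′ , refl) , refl) →
       j + j′ , +-mono-≤ j≤q j′≤q′ , regroup d x j x′ j′ }) ,
  (λ { (j , j≤q+q′ , refl) →
       -- The first progression takes as many of the j steps as it can; the remaining `j ∸ q` are at
       -- most q′ because j ≤ q + q′.
       x + d * (q ⊓ j) , x′ + d * (j ∸ q) ,
       (q ⊓ j , m⊓n≤m q j , refl) ,
       (j ∸ q , m≤n+o⇒m∸n≤o j q j≤q+q′ , refl) ,
       trans (cong (λ k → x + x′ + d * k) (sym (m⊓n+n∸m≡n q j)))
             (sym (regroup d x (q ⊓ j) x′ (j ∸ q))) })
  where
  regroup : ∀ d x j x′ j′ → x + d * j + (x′ + d * j′) ≡ x + x′ + d * (j + j′)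
  regroup = solve-∀

-- The least element recovers x and the greatest, x + d·q, then recovers q by cancelling the nonzero
-- factor d.
progression-injective : ∀ d .⦃ _ : NonZero d ⦄ x q x′ q′ →
  (x + d ·[0, q ]) ≐ (x′ + d ·[0, q′ ]) → (x , q) ≡ (x′ , q′)
progression-injective d x q x′ q′ (P⊆P′ , P′⊆P) = cong₂ _,_ x≡x′ q≡q′
  where
  min : ∀ x q → x ∈ (x + d ·[0, q ])
  min x q = 0 , z≤n , sym (trans (cong (x +_) (*-zeroʳ d)) (+-identityʳ x))

  max : ∀ x q → x + d * q ∈ (x + d ·[0, q ])
  max x q = q , ≤-refl , refl

  min-≤ : ∀ {x q m} → m ∈ (x + d ·[0, q ]) → x ≤ m
  min-≤ (j , _ , refl) = m≤m+n _ (d * j)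

  ≤-max : ∀ {x q m} → m ∈ (x + d ·[0, q ]) → m ≤ x + d * q
  ≤-max {x} (j , j≤q , refl) = +-monoʳ-≤ x (*-monoʳ-≤ d j≤q)

  x≡x′ : x ≡ x′
  x≡x′ = ≤-antisym (min-≤ (P′⊆P (min x′ q′))) (min-≤ (P⊆P′ (min x q)))

  q≡q′ : q ≡ q′
  q≡q′ = *-cancelˡ-≡ q q′ d (+-cancelˡ-≡ x (d * q) (d * q′)
    (trans (≤-antisym (≤-max (P⊆P′ (max x q))) (≤-max (P′⊆P (max x′ q′))))
           (cong (_+ d * q′) (sym x≡x′))))

-- Normal forms in B_n, with d = n - 2.

module Lengths (d : ℕ) where

  open Presentation (BRel (2 + d))

  -- The pair (i , j) stands for the normal form aⁱ bʲ.
  prepend : Gen → ℕ × ℕ → ℕ × ℕ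
  prepend a (i , j) = suc i , j
  prepend b (i , j) = 0 , suc (i * suc d + j)

  act : List Gen → ℕ × ℕ → ℕ × ℕ
  act w s = foldr prepend s w

  normalForm : List Gen → ℕ × ℕ
  normalForm w = act w (0 , 0)

  act-replicate-a : ∀ k i j → act (replicate k a) (i , j) ≡ (k + i , j)
  act-replicate-a zero    i j = refl
  act-replicate-a (suc k) i j = cong (prepend a) (act-replicate-a k i j)

  act-replicate-b : ∀ k i j → act (replicate (suc k) b) (i , j) ≡ (0 , suc (k + (i * suc d + j)))
  act-replicate-b zero    i j = refl
  act-replicate-b (suc k) i j = cong (prepend b) (act-replicate-b k i j)

  -- Only the defining relation needs a computation: both of its sides send (i , j) to (0 , (2 + d)
  -- + i(d + 1) + j), differing only in the bracketing of the sum.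
  act-cong : ∀ {u v} → u ∼ v → ∀ s → act u s ≡ act v s
  act-cong (relation ba≈bⁿ) (i , j) =
    trans (cong (λ k → 0 , suc k) (+-assoc (suc d) (i * suc d) j))
          (sym (act-replicate-b (suc d) i j))
  act-cong ∼-refl s = refl
  act-cong (∼-sym u∼v) s = sym (act-cong u∼v s)
  act-cong (∼-trans u∼v v∼w) s = trans (act-cong u∼v s) (act-cong v∼w s)
  act-cong (∼-cong {u} {u′} {v} {v′} u∼u′ v∼v′) s = begin
    act (u ++ v) s     ≡⟨ foldr-++ prepend s u v ⟩
    act u (act v s)    ≡⟨ cong (act u) (act-cong v∼v′ s) ⟩
    act u (act v′ s)   ≡⟨ act-cong u∼u′ (act v′ s) ⟩
    act u′ (act v′ s)  ≡⟨ foldr-++ prepend s u′ v′ ⟨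
    act (u′ ++ v′) s   ∎
    where open ≡-Reasoning

  toWord : ℕ × ℕ → List Gen
  toWord (i , j) = replicate i a ++ replicate j b

  ∷-cong : ∀ g {u v} → u ∼ v → g ∷ u ∼ g ∷ v
  ∷-cong g = ∼-cong (∼-refl {g ∷ []})

  -- Only the last b of the block meets w; the others stay in front untouched.
  replicate-b-++ : ∀ k {w l} → b ∷ w ∼ replicate (suc l) b →
    replicate (suc k) b ++ w ∼ replicate (suc (k + l)) b
  replicate-b-++ zero    bw∼ = bw∼
  replicate-b-++ (suc k) bw∼ = ∷-cong b (replicate-b-++ k bw∼)

  -- Induction on i: rewriting the leading ba as a block of 2 + d letters b trades one a for d + 1
  -- additional b's, and the last b of the block then meets the next a.
  b∷toWord : ∀ i j → b ∷ toWord (i , j) ∼ replicate (suc (i * suc d + j)) b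
  b∷toWord zero    j = ∼-refl
  b∷toWord (suc i) j = ∼-trans
    (∼-cong (relation ba≈bⁿ) (∼-refl {toWord (i , j)}))
    (∼-trans (replicate-b-++ (suc d) (b∷toWord i j))
             (≡⇒∼ (cong (λ k → replicate (suc k) b) (sym (+-assoc (suc d) (i * suc d) j)))))

  toWord-normalForm : ∀ w → w ∼ toWord (normalForm w)
  toWord-normalForm []      = ∼-refl
  toWord-normalForm (a ∷ w) = ∷-cong a (toWord-normalForm w)
  toWord-normalForm (b ∷ w) = ∼-trans (∷-cong b (toWord-normalForm w))
    (b∷toWord (proj₁ (normalForm w)) (proj₂ (normalForm w)))

  normalForm-injective : ∀ u v → normalForm u ≡ normalForm v → u ∼ v
  normalForm-injective u v eq = ∼-trans (toWord-normalForm u)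
    (∼-trans (≡⇒∼ (cong toWord eq)) (∼-sym (toWord-normalForm v)))

  -- Lengths of the words with a given normal form.

  -- t counts the letters a lying to the right of some letter b.
  HasLength : ℕ × ℕ → Pred ℕ 0ℓ
  HasLength (i , j) k = ∃[ t ] (t * suc d ≤ pred j × k + d * t ≡ i + j)

  length-normalForm : ∀ w → HasLength (normalForm w) (length w)
  length-normalForm [] = 0 , z≤n , *-zeroʳ d
  length-normalForm (a ∷ w) with t , t≤ , eq ← length-normalForm w = t , t≤ , cong suc eq
  length-normalForm (b ∷ w) with t , t≤ , eq ← length-normalForm w =
    -- The i leading letters a of w now lie behind the new b, so they join the t counted before.
    i + t ,
    ≤-trans (≤-reflexive (*-distribʳ-+ (suc d) i t)) (+-monoʳ-≤ (i * suc d) (≤-trans t≤ pred[n]≤n)) ,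
    cong suc (begin
      length w + d * (i + t)        ≡⟨ lemma₁ (length w) d i t ⟩
      length w + d * t + d * i      ≡⟨ cong (_+ d * i) eq ⟩
      i + j + d * i                 ≡⟨ lemma₂ i j d ⟩
      i * suc d + j                 ∎)
    where
    open ≡-Reasoning
    i = proj₁ (normalForm w)
    j = proj₂ (normalForm w)
    lemma₁ : ∀ l d i t → l + d * (i + t) ≡ l + d * t + d * i
    lemma₁ = solve-∀
    lemma₂ : ∀ i j d → i + j + d * i ≡ i * suc d + j
    lemma₂ = solve-∀

  length-toWord : ∀ i j → length (toWord (i , j)) ≡ i + j
  length-toWord i j = trans (length-++ (replicate i a))
    (cong₂ _+_ (length-replicate i) (length-replicate j))

  normalForm-toWord : ∀ i j → normalForm (toWord (i , j)) ≡ (i , j)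
  normalForm-toWord i j = begin
    act (replicate i a ++ replicate j b) (0 , 0)  ≡⟨ foldr-++ prepend (0 , 0) (replicate i a) _ ⟩
    act (replicate i a) (normalForm (replicate j b)) ≡⟨ cong (act (replicate i a)) (bs j) ⟩
    act (replicate i a) (0 , j)                   ≡⟨ act-replicate-a i 0 j ⟩
    (i + 0 , j)                                   ≡⟨ cong (_, j) (+-identityʳ i) ⟩
    (i , j)                                       ∎
    where
    open ≡-Reasoning
    bs : ∀ j → normalForm (replicate j b) ≡ (0 , j)
    bs zero    = refl
    bs (suc j) = cong (prepend b) (bs j)

  -- For aⁱbʲ⁺¹ the word is aⁱ b aᵗ bᵐ: its first b absorbs the t letters a, producing t(d + 1)
  -- further b's, and m = j - t(d + 1) supplies the rest.
  wordOfLength : ∀ s {k} → HasLength s k → ∃[ w ] (normalForm w ≡ s × length w ≡ k)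
  -- Without any b the bound t(d + 1) ≤ 0 leaves only t = 0.
  wordOfLength (i , zero) {k} (zero , _ , eq) =
    toWord (i , 0) , normalForm-toWord i 0 ,
    trans (length-toWord i 0) (trans (sym eq) (trans (cong (k +_) (*-zeroʳ d)) (+-identityʳ k)))
  wordOfLength (i , suc j) {k} (t , t≤ , eq) =
    replicate i a ++ b ∷ toWord (t , m) ,
    (begin
      act (replicate i a ++ b ∷ toWord (t , m)) (0 , 0)
        ≡⟨ foldr-++ prepend (0 , 0) (replicate i a) _ ⟩
      act (replicate i a) (prepend b (normalForm (toWord (t , m))))
        ≡⟨ cong (act (replicate i a) ∘ prepend b) (normalForm-toWord t m) ⟩
      act (replicate i a) (0 , suc (t * suc d + m))
        ≡⟨ act-replicate-a i 0 _ ⟩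
      (i + 0 , suc (t * suc d + m))
        ≡⟨ cong₂ _,_ (+-identityʳ i) (cong suc t+m≡j) ⟩
      (i , suc j) ∎) ,
    -- The length k is known only through k + d·t = i + j + 1, so the comparison is made after
    -- adding d·t to both sides.
    +-cancelʳ-≡ (d * t) _ k (begin
      length (replicate i a ++ b ∷ toWord (t , m)) + d * t
        ≡⟨ cong (_+ d * t) (length-++ (replicate i a)) ⟩
      length (replicate i a) + suc (length (toWord (t , m))) + d * t
        ≡⟨ cong₂ (λ x y → x + suc y + d * t) (length-replicate i) (length-toWord t m) ⟩
      i + suc (t + m) + d * t
        ≡⟨ regroup i t m d ⟩
      i + suc (t * suc d + m)
        ≡⟨ cong (λ y → i + suc y) t+m≡j ⟩
      i + suc j
        ≡⟨ eq ⟨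
      k + d * t ∎)
    where
    open ≡-Reasoning
    m = j ∸ t * suc d
    t+m≡j : t * suc d + m ≡ j
    t+m≡j = m+[n∸m]≡n t≤
    regroup : ∀ i t m d → i + suc (t + m) + d * t ≡ i + suc (t * suc d + m)
    regroup = solve-∀

  -- Units, atoms and factorizations in B_n.

  length≤ : ∀ w → length w ≤ proj₁ (normalForm w) + proj₂ (normalForm w)
  -- Dropping d·t shows that the normal form is a longest word of its class.
  length≤ w with t , _ , eq ← length-normalForm w = ≤-trans (m≤m+n _ (d * t)) (≤-reflexive eq)

  -- A unit followed by its inverse has normal form (0 , 0), so `length≤` leaves room for no letter.
  unit⇒[] : ∀ u → IsUnit (B (2 + d)) u → u ≡ []
  unit⇒[] [] _ = refl
  unit⇒[] u@(_ ∷ _) (v , _ , uv∼[])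
    with () ← ≤-trans (length≤ (u ++ v))
                (≤-reflexive (cong (λ (i , j) → i + j) (act-cong uv∼[] (0 , 0))))

  []-isUnit : IsUnit (B (2 + d)) []
  []-isUnit = [] , ∼-refl , ∼-refl

  singleton-isAtom : ∀ g → IsAtom (B (2 + d)) (g ∷ [])
  singleton-isAtom g = (λ unit → contradiction (unit⇒[] (g ∷ []) unit) λ ()) , split
    where
    size : ∀ g → let (i , j) = normalForm (g ∷ []) in i + j ≡ 1
    size a = refl
    size b = refl
    split : ∀ x y → g ∷ [] ∼ x ++ y → IsUnit (B (2 + d)) x ⊎ IsUnit (B (2 + d)) y
    split [] y g∼ = inj₁ []-isUnit
    split (_ ∷ _) [] g∼ = inj₂ []-isUnit
    -- Two nonempty factors have at least two letters together, while `length≤` and `size` allow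
    -- only one.
    split x@(_ ∷ x′) y@(_ ∷ y′) g∼
      with s≤s le ← ≤-trans (length≤ (x ++ y))
             (≤-reflexive (trans (cong (λ (i , j) → i + j) (act-cong (∼-sym g∼) (0 , 0))) (size g)))
      with () ← ≤-trans (m≤n+m (length y) (length x′)) (≤-trans (≤-reflexive (sym (length-++ x′))) le)

  -- A longer word splits after its first letter into two nonempty words, neither of them a unit.
  atom⇒length≡1 : ∀ u → IsAtom (B (2 + d)) u → length u ≡ 1
  atom⇒length≡1 [] (nonunit , _) = contradiction []-isUnit nonunit
  atom⇒length≡1 (_ ∷ []) _ = refl
  atom⇒length≡1 (g ∷ h ∷ u) (_ , split) with split (g ∷ []) (h ∷ u) ∼-refl
  ... | inj₁ unit = contradiction (unit⇒[] _ unit) λ ()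
  ... | inj₂ unit = contradiction (unit⇒[] _ unit) λ ()

  length-prod : ∀ us → All (IsAtom (B (2 + d))) us → length (prod (B (2 + d)) us) ≡ length us
  length-prod [] [] = refl
  length-prod (u ∷ us) (p ∷ ps) = trans (length-++ u)
    (cong₂ _+_ (atom⇒length≡1 u p) (length-prod us ps))

  letters-isAtom : ∀ w → All (IsAtom (B (2 + d))) (map (_∷ []) w)
  letters-isAtom [] = []
  letters-isAtom (g ∷ w) = singleton-isAtom g ∷ letters-isAtom w

  prod-letters : ∀ w → prod (B (2 + d)) (map (_∷ []) w) ≡ w
  prod-letters [] = refl
  prod-letters (g ∷ w) = cong (g ∷_) (prod-letters w)

  -- Atoms are one-letter words, so factorizing y amounts to choosing a word in its class and
  -- reading it letter by letter.
  𝖫≐HasLength : ∀ y → 𝖫 (B (2 + d)) y ≐ HasLength (normalForm y)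
  𝖫≐HasLength y =
    (λ { (us , refl , atoms , us∼y) →
         subst (HasLength (normalForm y)) (length-prod us atoms)
           (subst (λ s → HasLength s (length (prod (B (2 + d)) us))) (act-cong us∼y (0 , 0))
             (length-normalForm (prod (B (2 + d)) us))) }) ,
    (λ {k} hasLength → let (w , nf≡ , len≡) = wordOfLength (normalForm y) hasLength in
       map (_∷ []) w , trans (length-map (_∷ []) w) len≡ , letters-isAtom w ,
       ∼-trans (≡⇒∼ (prod-letters w)) (normalForm-injective w y nf≡))

  -- Sets of lengths as progressions.

  parameters : ℕ × ℕ → ℕ × ℕ
  parameters (i , zero)  = i , 0
  -- With j = q(d + 1) + r, the largest admissible t is q, and the shortest length is i + 1 + j -
  -- d·q = i + 1 + r + q.
  parameters (i , suc j) = i + suc (j % suc d + j / suc d) , j / suc d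

  parameters∈H : ∀ s → InH (parameters s)
  parameters∈H (zero  , zero)  = inj₁ (refl , refl)
  parameters∈H (suc i , zero)  = inj₂ (s≤s z≤n)
  parameters∈H (i     , suc j) = inj₂ (≤-trans (s≤s (m≤n+m _ _)) (m≤n+m _ i))

  -- Each additional a behind a b shortens the word by d, so t corresponds to the step `q ∸ t` of
  -- the progression: t = q gives the minimum and t = 0 the maximum.
  HasLength≐progression : ∀ s → let (x , q) = parameters s in HasLength s ≐ (x + d ·[0, q ])
  HasLength≐progression (i , zero) =
    (λ { {k} (zero , z≤n , eq) → 0 , z≤n ,
         trans (sym (+-identityʳ k)) (trans (cong (k +_) (sym (*-zeroʳ d)))
           (trans eq (cong (i +_) (sym (*-zeroʳ d))))) }) ,
    (λ { (zero , z≤n , refl) → 0 , z≤n ,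
         trans (+-assoc i (d * 0) (d * 0)) (cong (i +_) (cong₂ _+_ (*-zeroʳ d) (*-zeroʳ d))) })
  HasLength≐progression (i , suc j) =
    (λ { {k} (t , t≤ , eq) →
         let t≤q = ≤-trans (≤-reflexive (sym (m*n/n≡m t (suc d)))) (/-monoˡ-≤ (suc d) t≤) in
         q ∸ t , m∸n≤m q t ,
         +-cancelʳ-≡ (d * t) k _ (trans eq (sym (total (q ∸ t) t (m∸n+n≡m t≤q)))) }) ,
    (λ { (l , l≤q , refl) →
         q ∸ l ,
         ≤-trans (*-monoˡ-≤ (suc d) (m∸n≤m q l))
           (≤-trans (m≤n+m (q * suc d) r) (≤-reflexive (sym j≡))) ,
         total l (q ∸ l) (m+[n∸m]≡n l≤q) })
    where
    q = j / suc d
    r = j % suc d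
    j≡ : j ≡ r + q * suc d
    j≡ = m≡m%n+[m/n]*n j (suc d)
    regroup : ∀ i r d l t → i + suc (r + (l + t)) + d * l + d * t ≡ i + suc (r + (l + t) * suc d)
    regroup = solve-∀
    total : ∀ l t → l + t ≡ q → i + suc (r + q) + d * l + d * t ≡ i + suc j
    total l t l+t≡q = begin
      i + suc (r + q) + d * l + d * t        ≡⟨ cong (λ q → i + suc (r + q) + d * l + d * t) l+t≡q ⟨
      i + suc (r + (l + t)) + d * l + d * t  ≡⟨ regroup i r d l t ⟩
      i + suc (r + (l + t) * suc d)          ≡⟨ cong (λ q → i + suc (r + q * suc d)) l+t≡q ⟩
      i + suc (r + q * suc d)                ≡⟨ cong (λ j → i + suc j) j≡ ⟨
      i + suc j                              ∎
      where open ≡-Reasoning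

  𝖫≐progression : ∀ y → let (x , q) = parameters (normalForm y) in 𝖫 (B (2 + d)) y ≐ (x + d ·[0, q ])
  𝖫≐progression y = ≐-trans (𝖫≐HasLength y) (HasLength≐progression (normalForm y))

  -- For x > q, the exponent of b is chosen so that division by d + 1 leaves quotient q and
  -- remainder 0. The shortest length is then q + 1 plus the exponent of a, which fixes that
  -- exponent as x - q - 1.
  word : ∀ x q → InH (x , q) → List Gen
  word x q (inj₁ _) = []
  word x q (inj₂ _) = toWord (x ∸ suc q , suc (q * suc d))

  parameters-word : ∀ x q (p : InH (x , q)) → parameters (normalForm (word x q p)) ≡ (x , q)
  parameters-word x q (inj₁ (refl , refl)) = refl
  parameters-word x q (inj₂ q<x) = trans
    (cong parameters (normalForm-toWord (x ∸ suc q) (suc (q * suc d))))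
    (cong₂ _,_
      (trans (cong₂ (λ r l → x ∸ suc q + suc (r + l)) (m*n%n≡0 q (suc d)) (m*n/n≡m q (suc d)))
             (m∸n+n≡m q<x))
      (m*n/n≡m q (suc d)))

  progression∈𝓛 : ∀ {P x q} → InH (x , q) → P ≐ (x + d ·[0, q ]) → P ∈ 𝓛 (B (2 + d))
  progression∈𝓛 {P} {x} {q} p P≐ = word x q p ,
    ≐-trans P≐ (≐-sym (subst (λ (x , q) → 𝖫 (B (2 + d)) (word _ _ p) ≐ (x + d ·[0, q ]))
      (parameters-word x q p) (𝖫≐progression (word x q p))))

  -- The isomorphism onto H.

  Φ : Σ (Pred ℕ 0ℓ) (𝓛 (B (2 + d))) → ℋ.Carrier
  -- The pair is read off the word y stored as a witness; that it depends only on the set is shown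
  -- by `Φ-unique`.
  Φ (_ , y , _) = parameters (normalForm y) , parameters∈H (normalForm y)

  progression : ℋ.Carrier → Pred ℕ 0ℓ
  progression ((x , q) , _) = x + d ·[0, q ]

  Φ-spec : ∀ L → proj₁ L ≐ progression (Φ L)
  Φ-spec (_ , y , L≐𝖫y) = ≐-trans L≐𝖫y (𝖫≐progression y)

  progression-cong : ∀ {g h} → g ℋ.≈ h → progression g ≐ progression h
  progression-cong {g} {h} g≈h = subst (λ (x , q) → progression g ≐ (x + d ·[0, q ])) g≈h ≐-refl

  Φ-⊕ : ∀ L₁ L₂ → (proj₁ L₁ ⊕ proj₁ L₂) ≐ progression (Φ L₁ ℋ.∙ Φ L₂)
  Φ-⊕ L₁ L₂ = ≐-trans (⊕-cong (Φ-spec L₁) (Φ-spec L₂)) (progression-⊕ d _ _ _ _)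

  𝓛-closed : ClosedUnder⊕ (𝓛 (B (2 + d)))
  𝓛-closed P Q P∈ Q∈ = progression∈𝓛
    (proj₂ (Φ (P , P∈) ℋ.∙ Φ (Q , Q∈))) (Φ-⊕ (P , P∈) (Q , Q∈))

  0∈𝓛 : ｛ 0 ｝ ∈ 𝓛 (B (2 + d))
  0∈𝓛 = progression∈𝓛 (inj₁ (refl , refl)) (｛0｝≐progression d)

  module _ .⦃ _ : NonZero d ⦄ where

    -- Here d ≠ 0 enters, through injectivity of the progressions. Congruence, both homomorphism
    -- laws and surjectivity reduce to this uniqueness.
    Φ-unique : ∀ L h → proj₁ L ≐ progression h → Φ L ℋ.≈ h
    Φ-unique L h L≐ = progression-injective d _ _ _ _ (≐-trans (≐-sym (Φ-spec L)) L≐)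

    Φ-characterisation : ∀ L x q (xq∈H : InH (x , q)) →
      (proj₁ L ≐ (x + d ·[0, q ])) ⇔ (Φ L ℋ.≈ ((x , q) , xq∈H))
    Φ-characterisation L x q xq∈H = mk⇔ (Φ-unique L ((x , q) , xq∈H))
      (λ eq → ≐-trans (Φ-spec L) (progression-cong {Φ L} {(x , q) , xq∈H} eq))

    Φ-isMonoidIsomorphism : IsMonoidIsomorphism (sumsetRawMonoid (𝓛 (B (2 + d))) 𝓛-closed 0∈𝓛) H Φ
    Φ-isMonoidIsomorphism = record
      { isMonoidMonomorphism = record
        { isMonoidHomomorphism = record
          { isMagmaHomomorphism = record
            { isRelHomomorphism = record
              { cong = λ {L} {L′} L≐L′ → Φ-unique L (Φ L′) (≐-trans L≐L′ (Φ-spec L′)) }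
            ; homo = λ L₁ L₂ → Φ-unique
                (proj₁ L₁ ⊕ proj₁ L₂ , 𝓛-closed _ _ (proj₂ L₁) (proj₂ L₂))
                (Φ L₁ ℋ.∙ Φ L₂) (Φ-⊕ L₁ L₂)
            }
          ; ε-homo = Φ-unique (｛ 0 ｝ , 0∈𝓛) ℋ.ε (｛0｝≐progression d)
          }
        ; injective = λ {L} {L′} eq →
            ≐-trans (Φ-spec L) (≐-trans (progression-cong {Φ L} {Φ L′} eq) (≐-sym (Φ-spec L′)))
        }
      ; surjective = λ h → (progression h , progression∈𝓛 (proj₂ h) ≐-refl) ,
          λ {L} L≐ → Φ-unique L h L≐
      }

-- Arithmetic of the monoid H.

H-isCommutativeMonoid : IsCommutativeMonoid ℋ._≈_ ℋ._∙_ ℋ.ε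
H-isCommutativeMonoid = record
  { isMonoid = record
    { isSemigroup = record
      { isMagma = record
        { isEquivalence = record { refl = refl ; sym = sym ; trans = trans }
        ; ∙-cong        = cong₂ λ (k , i) (k′ , i′) → k + k′ , i + i′
        }
      ; assoc = λ ((k , i) , _) ((k′ , i′) , _) ((k″ , i″) , _) →
          cong₂ _,_ (+-assoc k k′ k″) (+-assoc i i′ i″)
      }
    ; identity = (λ _ → refl) ,
        (λ ((k , i) , _) → cong₂ _,_ (+-identityʳ k) (+-identityʳ i))
    }
  ; comm = λ ((k , i) , _) ((k′ , i′) , _) → cong₂ _,_ (+-comm k k′) (+-comm i i′)
  }

H-reduced : Reduced H
H-reduced ((k , i) , _) (((k′ , i′) , _) , _ , eq) =
  cong₂ _,_ (m+n≡0⇒m≡0 k (cong proj₁ eq)) (m+n≡0⇒m≡0 i (cong proj₂ eq))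

H-cancellative : Cancellative ℋ._≈_ ℋ._∙_
H-cancellative =
  (λ ((k , i) , _) _ _ eq → cong₂ _,_
    (+-cancelˡ-≡ k _ _ (cong proj₁ eq)) (+-cancelˡ-≡ i _ _ (cong proj₂ eq))) ,
  (λ ((k , i) , _) _ _ eq → cong₂ _,_
    (+-cancelʳ-≡ k _ _ (cong proj₁ eq)) (+-cancelʳ-≡ i _ _ (cong proj₂ eq)))

ε-isUnit : ∀ p → IsUnit H ((0 , 0) , p)
ε-isUnit _ = ℋ.ε , refl , refl

-- A sum of two non-zero elements satisfies i + 2 ≤ k.
[1+i,i]-isAtom : ∀ i (p : InH (suc i , i)) → IsAtom H ((suc i , i) , p)
[1+i,i]-isAtom i p = (λ unit → contradiction (cong proj₁ (H-reduced ((suc i , i) , p) unit)) λ ()) , split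
  where
  split : ∀ x y → (suc i , i) ≡ proj₁ (x ℋ.∙ y) → IsUnit H x ⊎ IsUnit H y
  split (_ , p@(inj₁ (refl , refl))) y eq = inj₁ (ε-isUnit p)
  split (_ , inj₂ _) (_ , p@(inj₁ (refl , refl))) eq = inj₂ (ε-isUnit p)
  split ((k , j) , inj₂ j<k) ((k′ , j′) , inj₂ j′<k′) eq = contradiction
    (subst (suc (suc (j + j′)) ≤_) (sym (cong proj₁ eq))
      (subst (_≤ k + k′) (cong suc (+-suc j j′)) (+-mono-≤ j<k j′<k′)))
    (subst (λ j → ¬ (suc (suc j) ≤ suc i)) (cong proj₂ eq) (<-irrefl refl))

n∈H : ∀ n → InH (n , 0)
n∈H zero    = inj₁ (refl , refl)
n∈H (suc _) = inj₂ (s≤s z≤n)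

-- Split (k , i) as (i + 1 , i) + (k - i - 1 , 0). The first summand is never a unit, so for an atom
-- the second is, and reducedness makes it zero.
atom⇒k≡1+i : ∀ k i p → IsAtom H ((k , i) , p) → k ≡ suc i
atom⇒k≡1+i _ _ p@(inj₁ (refl , refl)) (nonunit , _) = contradiction (ε-isUnit p) nonunit
atom⇒k≡1+i k i (inj₂ i<k) (_ , split)
  with split ((suc i , i) , inj₂ ≤-refl) ((k ∸ suc i , 0) , n∈H (k ∸ suc i))
         (cong₂ _,_ (sym (m+[n∸m]≡n i<k)) (sym (+-identityʳ i)))
... | inj₁ unit = contradiction (cong proj₁ (H-reduced ((suc i , i) , inj₂ ≤-refl) unit)) λ ()
... | inj₂ unit = trans (sym (m+[n∸m]≡n i<k))
  (trans (cong (suc i +_) (cong proj₁ (H-reduced ((k ∸ suc i , 0) , n∈H (k ∸ suc i)) unit)))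
         (+-identityʳ (suc i)))

H-atoms : ∀ p → (Σ[ p∈H ∈ InH p ] IsAtom H (p , p∈H)) ⇔ (∃[ k ] (1 ≤ k × p ≡ (k , k ∸ 1)))
H-atoms (k , i) = mk⇔
  (λ (p , atom) → suc i , s≤s z≤n , cong (_, i) (atom⇒k≡1+i k i p atom))
  (λ { (suc i , _ , refl) → inj₂ ≤-refl , [1+i,i]-isAtom i (inj₂ ≤-refl) })

H-atomic : Atomic H
H-atomic (_ , p@(inj₁ (refl , refl))) nonunit = contradiction (ε-isUnit p) nonunit
H-atomic ((k , i) , inj₂ i<k) _ =
  -- One atom carries the whole second coordinate; copies of (1 , 0) fill up the first.
  ((suc i , i) , inj₂ ≤-refl) ∷ replicate (k ∸ suc i) one ,
  [1+i,i]-isAtom i (inj₂ ≤-refl) ∷ replicate⁺ (k ∸ suc i) ([1+i,i]-isAtom 0 (inj₂ ≤-refl)) ,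
  trans (cong (λ (l , j) → suc i + l , i + j) (prod-ones (k ∸ suc i)))
        (cong₂ _,_ (m+[n∸m]≡n i<k) (+-identityʳ i))
  where
  one : ℋ.Carrier
  one = (1 , 0) , inj₂ ≤-refl

  prod-ones : ∀ m → proj₁ (prod H (replicate m one)) ≡ (m , 0)
  prod-ones zero    = refl
  prod-ones (suc m) = cong (λ (l , j) → suc l , j) (prod-ones m)

-- Every atom contributes exactly 1 to k - i, so the product alone determines the number of factors;
-- half-factoriality follows.
length-factorization : ∀ us → All (IsAtom H) us →
  let (k , i) = proj₁ (prod H us) in k ≡ length us + i
length-factorization [] [] = refl
length-factorization (((k , i) , p) ∷ us) (atom ∷ atoms) =
  trans (cong₂ _+_ (atom⇒k≡1+i k i p atom) (length-factorization us atoms))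
        (cong suc (exchange i (length us) _))
  where
  exchange : ∀ i l j → i + (l + j) ≡ l + (i + j)
  exchange = solve-∀

H-halfFactorial : HalfFactorial H
H-halfFactorial ((x , q) , _) _ _ _ (us , refl , atoms , eq) (vs , refl , atoms′ , eq′) =
  +-cancelʳ-≡ q (length us) (length vs) (trans (sym (x≡ us atoms eq)) (x≡ vs atoms′ eq′))
  where
  x≡ : ∀ us → All (IsAtom H) us → proj₁ (prod H us) ≡ (x , q) → x ≡ length us + q
  x≡ us atoms eq = subst (λ (k , i) → k ≡ length us + i) eq (length-factorization us atoms)

theorem4p5 : (n : ℕ) → 3 ≤ n →
  (Σ[ closed ∈ ClosedUnder⊕ (𝓛 (B n)) ]
   Σ[ 0∈𝓛 ∈ ｛ 0 ｝ ∈ 𝓛 (B n) ]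
     (let 𝓛B = sumsetRawMonoid (𝓛 (B n)) closed 0∈𝓛
          module S = RawMonoid 𝓛B
          module H = RawMonoid H
      in IsMonoid S._≈_ S._∙_ S.ε
       × (Σ[ Φ ∈ (S.Carrier → H.Carrier) ]
            ((∀ L x q (xq∈H : InH (x , q)) →
                (proj₁ L ≐ (x + (n ∸ 2) ·[0, q ])) ⇔ (Φ L H.≈ ((x , q) , xq∈H)))
             × IsMonoidIsomorphism 𝓛B H Φ))))
  × (let module H = RawMonoid H
     in IsCommutativeMonoid H._≈_ H._∙_ H.ε
      × Reduced H
      × Atomic H
      × Cancellative H._≈_ H._∙_
      × HalfFactorial H
      × (∀ p → (Σ[ p∈H ∈ InH p ] IsAtom H (p , p∈H)) ⇔ (∃[ k ] (1 ≤ k × p ≡ (k , k ∸ 1)))))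
-- Matching on 3 ≤ n turns n - 2 into `suc d`, which supplies the `NonZero` instance.
theorem4p5 (suc (suc (suc d))) (s≤s (s≤s (s≤s z≤n))) =
  (𝓛-closed , 0∈𝓛 , sumset-isMonoid _ 𝓛-closed 0∈𝓛 ,
    Φ , Φ-characterisation , Φ-isMonoidIsomorphism) ,
  (H-isCommutativeMonoid , H-reduced , H-atomic , H-cancellative , H-halfFactorial , H-atoms)
  where open Lengths (suc d)
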